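{- Let $n>2$ and $t>2$ be two positive integers. Then \[\varphi(C_n \boxdot P_t)=\begin{cases} 5, & \text{if } n\in\{3,4\},\\ n, & \text{if } 5\leq n\leq 2t+2,\\ 2t+3, & \text{otherwise}. \end{cases}\]
   Context: All graphs are finite and simple. $P_n$ and $C_n$ denote respectively the path and the cycle with $n$ vertices. The subdivision graph $S(G)$ of a graph $G$ is obtained by inserting one new vertex into every edge of $G$. For graphs $G$ and $H$, with $V(G)=\{u_0,\ldots,u_{m-1}\}$, the subdivision-vertex neighbourhood corona (SVN corona) $G\boxdot H$ is the graph obtained from $S(G)$ by adding $m$ vertex-disjoint copies of $H$ (one for each $u_i$) and joining, for each $i$, every vertex of $N_{S(G)}(u_i)$ (the neighbourhood of $u_i$ in $S(G)$) to every vertex of the copy of $H$ associated with $u_i$. A $b$-chromatic coloring of a graph with $k$ colors is a proper coloring with colors $0,\ldots,k-1$ such that, for each color $i$, there is a vertex (a $b$-vertex) of color $i$ having, for each color $j\neq i$, a neighbour of color $j$. The $b$-chromatic number $\varphi(G)$ is the maximum $k$ for which $G$ has a $b$-chromatic coloring with $k$ colors. -}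

module Defs where

open import Data.Empty using (⊥)
open import Data.Fin using (Fin; zero; suc; toℕ; _<_)
open import Data.Fin.Properties using (+↔⊎; *↔×; inj⇒≟; _<?_; toℕ<n)
open import Data.Irrelevant using ([_])
open import Data.Nat as ℕ using (ℕ; zero; suc)
import Data.Nat.Properties as ℕ
open import Data.Product using (Σ; ∃; ∃-syntax; _×_; _,_; proj₁; proj₂)
open import Data.Product.Function.NonDependent.Propositional using (_×-↔_)
open import Data.Refinement.Base using (Refinement; Refinement-syntax; value; _,_)
open import Data.Sum using (_⊎_; inj₁; inj₂; swap)
open import Data.Sum.Function.Propositional using (_⊎-↔_)
open import Function using (_∘_)
open import Function.Bundles using (_↔_; Inverse; mk↔ₛ′)
open import Function.Construct.Composition using (_↔-∘_)
open import Function.Construct.Identity using (↔-id)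
open import Function.Construct.Symmetry using (↔-sym)
open import Function.Properties.Inverse using (↔⇒↣)
open import Relation.Binary.Definitions
  using (Decidable; DecidableEquality; Irreflexive; Symmetric)
open import Relation.Binary.PropositionalEquality
  using (_≡_; _≢_; refl; sym; trans; cong; subst)
open import Relation.Nullary using (¬_; Dec; yes; no; contradiction-irr)
open import Relation.Nullary.Decidable using (_⊎-dec_; _×-dec_)
import Relation.Unary as U

record Graph : Set₁ where
  infix 4 _~_ _~?_
  field
    Vertex   : Set
    order    : ℕ
    finite   : Vertex ↔ Fin order
    _~_      : Vertex → Vertex → Set
    _~?_     : Decidable _~_
    ~-irrefl : Irreflexive _≡_ _~_
    ~-sym    : Symmetric _~_

  index : Vertex → Fin order
  index = Inverse.to finite

  _≟_ : DecidableEquality Vertex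
  _≟_ = inj⇒≟ (↔⇒↣ finite)

  -- Each unordered edge is represented once, by listing its endpoints in
  -- increasing order of index.
  IsEdge : Vertex × Vertex → Set
  IsEdge (u , v) = index u < index v × u ~ v

  isEdge? : U.Decidable IsEdge
  isEdge? (u , v) = (index u <? index v) ×-dec (u ~? v)

  Edge : Set
  Edge = [ e ∈ Vertex × Vertex ∣ IsEdge e ]

  _isEndOf_ : Vertex → Edge → Set
  v isEndOf e = v ≡ proj₁ (value e) ⊎ v ≡ proj₂ (value e)

  _isEndOf?_ : Decidable _isEndOf_
  v isEndOf? e = (v ≟ proj₁ (value e)) ⊎-dec (v ≟ proj₂ (value e))

open Graph using (Vertex; Edge)

private
  refineFin : ∀ n {P : Fin n → Set} → U.Decidable P →
              ∃[ m ] (Refinement (Fin n) P ↔ Fin m)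
  refineFin zero    P? = 0 , mk↔ₛ′ value (λ ()) (λ ()) (λ { (() , _) })
  refineFin (suc n) {P} P? with P? zero | refineFin n (P? ∘ suc)
  ... | yes p | m , r = suc m , mk↔ₛ′ to from to-from from-to
    where
    to : Refinement (Fin (suc n)) P → Fin (suc m)
    to (zero  , _) = zero
    to (suc i , q) = suc (Inverse.to r (i , q))

    lift : Refinement (Fin n) (P ∘ suc) → Refinement (Fin (suc n)) P
    lift (i , q) = suc i , q

    from : Fin (suc m) → Refinement (Fin (suc n)) P
    from zero    = zero , [ p ]
    from (suc k) = lift (Inverse.from r k)

    to-from : ∀ k → to (from k) ≡ k
    to-from zero    = refl
    to-from (suc k) = cong suc (Inverse.strictlyInverseˡ r k)

    from-to : ∀ x → from (to x) ≡ x
    from-to (zero  , _) = refl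
    from-to (suc i , q) = cong lift (Inverse.strictlyInverseʳ r (i , q))
  ... | no ¬p | m , r = m , mk↔ₛ′ to from (Inverse.strictlyInverseˡ r) from-to
    where
    to : Refinement (Fin (suc n)) P → Fin m
    to (zero  , [ q ]) = contradiction-irr q ¬p
    to (suc i , q)     = Inverse.to r (i , q)

    lift : Refinement (Fin n) (P ∘ suc) → Refinement (Fin (suc n)) P
    lift (i , q) = suc i , q

    from : Fin m → Refinement (Fin (suc n)) P
    from k = lift (Inverse.from r k)

    from-to : ∀ x → from (to x) ≡ x
    from-to (zero  , [ q ]) = contradiction-irr q ¬p
    from-to (suc i , q)     = cong lift (Inverse.strictlyInverseʳ r (i , q))

  refineFinite : ∀ {A : Set} {P : A → Set} {n} → A ↔ Fin n → U.Decidable P →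
                 ∃[ m ] (Refinement A P ↔ Fin m)
  refineFinite {A} {P} {n} A↔Fin P? =
    let m , r = refineFin n (P? ∘ from) in m , (r ↔-∘ transport)
    where
    open Inverse A↔Fin using (to; from; strictlyInverseˡ; strictlyInverseʳ)

    value-injective : ∀ {B : Set} {Q : B → Set} {x y : Refinement B Q} →
                      value x ≡ value y → x ≡ y
    value-injective refl = refl

    transport : Refinement A P ↔ Refinement (Fin n) (P ∘ from)
    transport = mk↔ₛ′
      (λ { (a , [ p ]) → to a , [ subst P (sym (strictlyInverseʳ a)) p ] })
      (λ { (i , p) → from i , p })
      (λ { (i , p) → value-injective (strictlyInverseˡ i) })
      (λ { (a , p) → value-injective (strictlyInverseʳ a) })

  finite-⊎ : ∀ {A B : Set} {m n} → A ↔ Fin m → B ↔ Fin n → (A ⊎ B) ↔ Fin (m ℕ.+ n)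
  finite-⊎ f g = ↔-sym +↔⊎ ↔-∘ (f ⊎-↔ g)

  finite-× : ∀ {A B : Set} {m n} → A ↔ Fin m → B ↔ Fin n → (A × B) ↔ Fin (m ℕ.* n)
  finite-× f g = ↔-sym *↔× ↔-∘ (f ×-↔ g)

edges-finite : (G : Graph) → ∃[ m ] (Edge G ↔ Fin m)
edges-finite G = refineFinite (finite-× finite finite) isEdge?
  where open Graph G

S : Graph → Graph
S G = record
  { Vertex   = Vertex G ⊎ Edge G
  ; order    = G.order ℕ.+ proj₁ (edges-finite G)
  ; finite   = finite-⊎ G.finite (proj₂ (edges-finite G))
  ; _~_      = _~_
  ; _~?_     = _~?_
  ; ~-irrefl = λ {x} {y} → ~-irrefl {x} {y}
  ; ~-sym    = λ {x} {y} → ~-sym {x} {y}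
  }
  where
  module G = Graph G

  _~_ : Vertex G ⊎ Edge G → Vertex G ⊎ Edge G → Set
  inj₁ u ~ inj₁ v = ⊥
  inj₁ u ~ inj₂ e = u G.isEndOf e
  inj₂ e ~ inj₁ u = u G.isEndOf e
  inj₂ e ~ inj₂ f = ⊥

  _~?_ : Decidable _~_
  inj₁ u ~? inj₁ v = no λ ()
  inj₁ u ~? inj₂ e = u G.isEndOf? e
  inj₂ e ~? inj₁ u = u G.isEndOf? e
  inj₂ e ~? inj₂ f = no λ ()

  ~-irrefl : Irreflexive _≡_ _~_
  ~-irrefl {inj₁ _} refl ()
  ~-irrefl {inj₂ _} refl ()

  ~-sym : Symmetric _~_
  ~-sym {inj₁ u} {inj₂ e} p = p
  ~-sym {inj₂ e} {inj₁ u} p = p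

infixr 5 _⊡_

-- The vertex `inj₂ (u , h)` is the vertex h in the copy of H associated with u.
_⊡_ : Graph → Graph → Graph
G ⊡ H = record
  { Vertex   = V
  ; order    = SG.order ℕ.+ G.order ℕ.* H.order
  ; finite   = finite-⊎ SG.finite (finite-× G.finite H.finite)
  ; _~_      = _~_
  ; _~?_     = _~?_
  ; ~-irrefl = λ {x} {y} → ~-irrefl {x} {y}
  ; ~-sym    = λ {x} {y} → ~-sym {x} {y}
  }
  where
  module G  = Graph G
  module H  = Graph H
  module SG = Graph (S G)

  V : Set
  V = Vertex (S G) ⊎ (Vertex G × Vertex H)

  _~_ : V → V → Set
  inj₁ x       ~ inj₁ y       = x SG.~ y
  inj₁ x       ~ inj₂ (u , h) = inj₁ u SG.~ x
  inj₂ (u , h) ~ inj₁ x       = inj₁ u SG.~ x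
  inj₂ (u , h) ~ inj₂ (v , k) = u ≡ v × h H.~ k

  _~?_ : Decidable _~_
  inj₁ x       ~? inj₁ y       = x SG.~? y
  inj₁ x       ~? inj₂ (u , h) = inj₁ u SG.~? x
  inj₂ (u , h) ~? inj₁ x       = inj₁ u SG.~? x
  inj₂ (u , h) ~? inj₂ (v , k) = (u G.≟ v) ×-dec (h H.~? k)

  ~-irrefl : Irreflexive _≡_ _~_
  ~-irrefl {inj₁ x} refl p       = SG.~-irrefl {x} refl p
  ~-irrefl {inj₂ _} refl (_ , p) = H.~-irrefl refl p

  ~-sym : Symmetric _~_
  ~-sym {inj₁ x} {inj₁ y} p       = SG.~-sym {x} {y} p
  ~-sym {inj₁ _} {inj₂ _} p       = p
  ~-sym {inj₂ _} {inj₁ _} p       = p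
  ~-sym {inj₂ _} {inj₂ _} (e , p) = sym e , H.~-sym p

P : ℕ → Graph
P n = record
  { Vertex   = Fin n
  ; order    = n
  ; finite   = ↔-id (Fin n)
  ; _~_      = λ i j → Next i j ⊎ Next j i
  ; _~?_     = λ i j → next? i j ⊎-dec next? j i
  ; ~-irrefl = λ { refl (inj₁ p) → ℕ.1+n≢n p ; refl (inj₂ p) → ℕ.1+n≢n p }
  ; ~-sym    = swap
  }
  where
  Next : Fin n → Fin n → Set
  Next i j = suc (toℕ i) ≡ toℕ j

  next? : Decidable Next
  next? i j = suc (toℕ i) ℕ.≟ toℕ j

-- For n ≤ 2 there is no simple cycle with n vertices.
C : (n : ℕ) → .(n ℕ.> 2) → Graph
C n n>2 = record
  { Vertex   = Fin n
  ; order    = n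
  ; finite   = ↔-id (Fin n)
  ; _~_      = λ i j → Next i j ⊎ Next j i
  ; _~?_     = λ i j → next? i j ⊎-dec next? j i
  ; ~-irrefl = λ { refl (inj₁ p) → next-irrefl p ; refl (inj₂ p) → next-irrefl p }
  ; ~-sym    = swap
  }
  where
  Next : Fin n → Fin n → Set
  Next i j = suc (toℕ i) ≡ toℕ j ⊎ (suc (toℕ i) ≡ n × toℕ j ≡ 0)

  next? : Decidable Next
  next? i j =
    (suc (toℕ i) ℕ.≟ toℕ j) ⊎-dec ((suc (toℕ i) ℕ.≟ n) ×-dec (toℕ j ℕ.≟ 0))

  next-irrefl : ∀ {i} → ¬ Next i i
  next-irrefl (inj₁ p)       = ℕ.1+n≢n p
  next-irrefl (inj₂ (p , q)) = contradiction-irr n>2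
    λ 2<n → ℕ.<⇒≢ (ℕ.<-trans (ℕ.s≤s (ℕ.s≤s ℕ.z≤n)) 2<n) (trans (cong suc (sym q)) p)

module _ (G : Graph) where
  open Graph G using (_~_)

  IsProper : ∀ {k} → (Vertex G → Fin k) → Set
  IsProper c = ∀ {u v} → u ~ v → c u ≢ c v

  IsBVertex : ∀ {k} → (Vertex G → Fin k) → Vertex G → Set
  IsBVertex c v = ∀ j → j ≢ c v → ∃[ w ] (v ~ w × c w ≡ j)

  IsBChromatic : ∀ {k} → (Vertex G → Fin k) → Set
  IsBChromatic c = IsProper c × (∀ i → ∃[ v ] (c v ≡ i × IsBVertex c v))

  HasBChromaticColouring : ℕ → Set
  HasBChromaticColouring k = Σ (Vertex G → Fin k) IsBChromatic

infix 4 φ_≡_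

-- φ as a relation, with k its (necessarily unique) value.
φ_≡_ : Graph → ℕ → Set
φ G ≡ k =
  HasBChromaticColouring G k × (∀ l → HasBChromaticColouring G l → l ℕ.≤ k)

{-# OPTIONS --safe #-}

-- Orient the cycle, so that the edge vertices of C n ⊡ P t correspond to the tails
-- i of the arcs. The other vertices have degree at most 4, so with more than 5
-- colours only the n edge vertices, of degree 2 t + 2, can be b-vertices.
--
-- For 5 ≤ k ≤ min(n, 2 t + 3) give the edge vertices the colours 0, …, k − 1, 0, 0, …
-- in cyclic order, and colour u_i together with its copy of P t by the colour of the
-- i-th edge vertex plus (modulo k) offsets from D = {1, 3, 5, …} ∪ {k − 2}. Since
-- D ∪ (D + 1) is the set of nonzero residues, each of the first k edge vertices sees
-- every other colour. For n = 3, 4 inner path vertices serve as further b-vertices.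
module Submission where

open import Defs
open import Data.Empty using (⊥; ⊥-elim)
open import Data.Fin as Fin using (Fin; zero; suc; toℕ; fromℕ<; combine; #_)
open import Data.Fin.Properties as Fin
  using (toℕ-injective; toℕ<n; toℕ-fromℕ<; combine-injective; injective⇒≤; any?; all?)
open import Data.Irrelevant using ([_])
open import Data.Nat
  using (ℕ; zero; suc; _+_; _*_; _∸_; _⊓_; ⌊_/2⌋; _≤_; _<_; _>_; z≤n; s≤s; z<s; s<s; NonZero)
open import Data.Nat.DivMod
  using (_%_; _mod_; m%n<n; m%n%n≡m%n; m<n⇒m%n≡m; [m+n]%n≡m%n; %-distribˡ-+)
open import Data.Nat.Properties
open import Data.Product using (_×_; ∃; ∃₂; ∃-syntax; _,_; proj₁; proj₂)
open import Data.Refinement.Base using (value; _,_)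
open import Data.Sum using (_⊎_; inj₁; inj₂; [_,_]′)
open import Data.Vec using (lookup; []; _∷_)
open import Function using (_∘_)
open import Relation.Binary.Definitions using (Decidable; tri<; tri≈; tri>)
open import Relation.Binary.PropositionalEquality
open import Relation.Nullary using (¬_; Dec; yes; no; contradiction; recompute)
open import Relation.Nullary.Decidable
  using (_⊎-dec_; _×-dec_; _→-dec_; ¬?; map′; from-yes)

-- The cyclic successor relation.

module _ {n : ℕ} where

  Next : Fin n → Fin n → Set
  Next i j = suc (toℕ i) ≡ toℕ j ⊎ (suc (toℕ i) ≡ n × toℕ j ≡ 0)

  next-functional : ∀ {i j j′} → Next i j → Next i j′ → j ≡ j′
  next-functional (inj₁ p) (inj₁ q) = toℕ-injective (trans (sym p) q)
  next-functional {j = j} (inj₁ p) (inj₂ (q , _)) =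
    contradiction (trans (sym p) q) (<⇒≢ (toℕ<n j))
  next-functional {j′ = j′} (inj₂ (p , _)) (inj₁ q) =
    contradiction (trans (sym q) p) (<⇒≢ (toℕ<n j′))
  next-functional (inj₂ (_ , p)) (inj₂ (_ , q)) = toℕ-injective (trans p (sym q))

  next-injective : ∀ {i i′ j} → Next i j → Next i′ j → i ≡ i′
  next-injective (inj₁ p) (inj₁ q) = toℕ-injective (suc-injective (trans p (sym q)))
  next-injective (inj₁ p) (inj₂ (_ , z)) = contradiction (trans p z) λ ()
  next-injective (inj₂ (_ , z)) (inj₁ q) = contradiction (trans q z) λ ()
  next-injective (inj₂ (p , _)) (inj₂ (q , _)) =
    toℕ-injective (suc-injective (trans p (sym q)))

next-total : ∀ {n} (i : Fin n) → ∃ (Next i)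
next-total {suc n} i with suc (toℕ i) <? suc n
... | yes i+1<n = fromℕ< i+1<n , inj₁ (sym (toℕ-fromℕ< i+1<n))
... | no i+1≮n  = zero , inj₂ (≤-antisym (toℕ<n i) (≮⇒≥ i+1≮n) , refl)

-- Fails on two vertices, where each one succeeds the other; hence for `n > 2` an edge can be
-- oriented in only one way.
next-asym : ∀ {n} → n > 2 → {i j : Fin n} → Next i j → ¬ Next j i
next-asym n>2 (inj₁ p) (inj₁ q) = m≢1+n+m _ {1} (sym (trans (cong suc p) q))
next-asym n>2 (inj₁ p) (inj₂ (q , z)) =
  <⇒≢ n>2 (trans (cong (2 +_) (sym z)) (trans (cong suc p) q))
next-asym n>2 (inj₂ (p , z)) (inj₁ q) =
  <⇒≢ n>2 (trans (cong (2 +_) (sym z)) (trans (cong suc q) p))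
next-asym n>2 (inj₂ (p , z)) (inj₂ (q , _)) =
  <⇒≢ (<-trans (s<s z<s) n>2) (trans (cong suc (sym z)) q)

-- Edges of the cycle as arcs, indexed by their tails.

module _ {n : ℕ} (n>2 : n > 2) where
  open Graph (C n n>2) using (IsEdge; isEdge?; _isEndOf_)

  -- Edges are stored by increasing index, so the edge closing the cycle is stored against its
  -- direction; hence the two alternatives.
  Arc : Graph.Edge (C n n>2) → Fin n → Fin n → Set
  Arc e i j = Next i j × (value e ≡ (i , j) ⊎ value e ≡ (j , i))

  arc : ∀ e → ∃₂ (Arc e)
  -- The adjacency proof is irrelevant; decidability recovers one that can be inspected for the
  -- direction.
  arc ((u , v) , [ p ]) with recompute (isEdge? (u , v)) p
  ... | _ , inj₁ u→v = u , v , u→v , inj₁ refl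
  ... | _ , inj₂ v→u = v , u , v→u , inj₂ refl

  tail : Graph.Edge (C n n>2) → Fin n
  tail e = proj₁ (arc e)

  end⇒tail : ∀ e {u} → u isEndOf e → u ≡ tail e ⊎ Next (tail e) u
  end⇒tail e p with arc e
  end⇒tail e (inj₁ refl) | _ , _ , _ , inj₁ refl = inj₁ refl
  end⇒tail e (inj₂ refl) | _ , _ , q , inj₁ refl = inj₂ q
  end⇒tail e (inj₁ refl) | _ , _ , q , inj₂ refl = inj₂ q
  end⇒tail e (inj₂ refl) | _ , _ , _ , inj₂ refl = inj₁ refl

  tail-isEnd : ∀ e → tail e isEndOf e
  tail-isEnd e with arc e
  ... | _ , _ , _ , inj₁ refl = inj₁ refl
  ... | _ , _ , _ , inj₂ refl = inj₂ refl

  next-isEnd : ∀ e {u} → Next (tail e) u → u isEndOf e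
  next-isEnd e q with arc e
  ... | _ , _ , r , inj₁ refl = inj₂ (next-functional q r)
  ... | _ , _ , r , inj₂ refl = inj₁ (next-functional q r)

  -- The tail determines the head. Equal arcs stored in opposite orders are impossible, since both
  -- orders would be increasing.
  tail-injective : ∀ {e f} → tail e ≡ tail f → e ≡ f
  tail-injective {e} {f} p = value-injective (sameValue p)
    where
    value-injective : ∀ {e f : Graph.Edge (C n n>2)} → value e ≡ value f → e ≡ f
    value-injective refl = refl

    ordered : ∀ e → proj₁ (value e) Fin.< proj₂ (value e)
    ordered (uv , [ p ]) = proj₁ (recompute (isEdge? uv) p)

    sameValue : tail e ≡ tail f → value e ≡ value f
    sameValue p with arc e | arc f | ordered e | ordered f
    sameValue refl | _ , _ , q , inj₁ refl | _ , _ , r , inj₁ refl | _ | _ =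
      cong (_ ,_) (next-functional q r)
    sameValue refl | _ , _ , q , inj₂ refl | _ , _ , r , inj₂ refl | _ | _ =
      cong (_, _) (next-functional q r)
    sameValue refl | _ , _ , q , inj₁ refl | _ , _ , r , inj₂ refl | i<j | j<i =
      ⊥-elim (<-asym i<j (subst (Fin._< _) (next-functional r q) j<i))
    sameValue refl | _ , _ , q , inj₂ refl | _ , _ , r , inj₁ refl | j<i | i<j =
      ⊥-elim (<-asym i<j (subst (Fin._< _) (next-functional q r) j<i))

  -- Otherwise `i` is the head of `e`, and `j` is either its tail, which reverses the arc, or also
  -- its head, which makes `i` a loop.
  tail-unique : ∀ e {i j} → Next i j → i isEndOf e → j isEndOf e → tail e ≡ i
  tail-unique e i→j i∈e j∈e with end⇒tail e i∈e | end⇒tail e j∈e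
  ... | inj₁ i≡t | _        = sym i≡t
  ... | inj₂ t→i | inj₁ j≡t = contradiction (subst (λ x → Next x _) (sym j≡t) t→i) (next-asym n>2 i→j)
  ... | inj₂ t→i | inj₂ t→j with next-functional t→i t→j
  ...   | refl = contradiction i→j (next-asym n>2 i→j)

  tail-surjective : ∀ i → ∃[ e ] tail e ≡ i
  tail-surjective i with next-total i
  ... | j , i→j with Fin.<-cmp i j
  ...   | tri< i<j _ _ = e , tail-unique e i→j (inj₁ refl) (inj₂ refl)
    where e = (i , j) , [ (i<j , inj₁ i→j) ]
  ...   | tri≈ _ refl _ = contradiction i→j (next-asym n>2 i→j)
  ...   | tri> _ _ j<i = e , tail-unique e i→j (inj₂ refl) (inj₁ refl)
    where e = (j , i) , [ (j<i , inj₂ i→j) ]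

-- Upper bounds from vertex degrees.

module _ (G : Graph) {k : ℕ} {c : Graph.Vertex G → Fin k} where
  open Graph G using (_~_)

  -- The injective labelling bounds the degree of `v` by `d`. Choosing a neighbour for each other
  -- colour, with the extra code `zero` for the colour of `v`, injects the colours into
  -- `Fin (suc d)`.
  bVertex⇒≤ : ∀ {d} v (label : ∀ {w} → v ~ w → Fin d) →
              (∀ {w w′} (p : v ~ w) (q : v ~ w′) → label p ≡ label q → w ≡ w′) →
              IsBVertex G c v → k ≤ suc d
  bVertex⇒≤ {d} v label label-injective b = injective⇒≤ code-injective
    where
    code : Fin k → Fin (suc d)
    code j with j Fin.≟ c v
    ... | yes _   = zero
    ... | no j≢cv = suc (label (proj₁ (proj₂ (b j j≢cv))))

    code-injective : ∀ {i j} → code i ≡ code j → i ≡ j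
    code-injective {i} {j} p with i Fin.≟ c v | j Fin.≟ c v
    ... | yes refl | yes refl = refl
    ... | yes _ | no _ = contradiction p λ ()
    ... | no _ | yes _ = contradiction p λ ()
    ... | no i≢ | no j≢ =
      let _ , p₁ , eq₁ = b i i≢
          _ , p₂ , eq₂ = b j j≢
      in trans (sym eq₁)
           (trans (cong c (label-injective p₁ p₂ (Fin.suc-injective p))) eq₂)

module _ {n t : ℕ} (n>2 : n > 2) where
  private
    G = C n n>2 ⊡ P t
    open Graph G using (Vertex; _~_)

  edge : Graph.Edge (C n n>2) → Vertex
  edge e = inj₁ (inj₂ e)

  private
    incident : ∀ {i} e → i ≡ tail n>2 e ⊎ Next (tail n>2 e) i → Fin 2
    incident _ (inj₁ _) = zero
    incident _ (inj₂ _) = suc zero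

    -- Each vertex is the tail of at most one edge and the head of at most one, so its role tells
    -- its edges apart.
    incident-injective : ∀ {i} e f (p : i ≡ tail n>2 e ⊎ Next (tail n>2 e) i)
      (q : i ≡ tail n>2 f ⊎ Next (tail n>2 f) i) →
      incident e p ≡ incident f q → e ≡ f
    incident-injective e f (inj₁ p) (inj₁ q) _ = tail-injective n>2 (trans (sym p) q)
    incident-injective e f (inj₂ p) (inj₂ q) _ = tail-injective n>2 (next-injective p q)

  cycleVertex⇒≤ : ∀ {k} {c : Vertex → Fin k} i → IsBVertex G c (inj₁ (inj₁ i)) → k ≤ 3
  cycleVertex⇒≤ i = bVertex⇒≤ G (inj₁ (inj₁ i)) (λ {w} → label {w})
    (λ {w} {w′} → label-injective {w} {w′})
    where
    label : ∀ {w} → inj₁ (inj₁ i) ~ w → Fin 2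
    label {inj₁ (inj₂ e)} p = incident e (end⇒tail n>2 e p)

    label-injective : ∀ {w w′} (p : inj₁ (inj₁ i) ~ w) (q : inj₁ (inj₁ i) ~ w′) →
                      label {w} p ≡ label {w′} q → w ≡ w′
    label-injective {inj₁ (inj₂ e)} {inj₁ (inj₂ f)} p q eq =
      cong edge (incident-injective e f (end⇒tail n>2 e p) (end⇒tail n>2 f q) eq)

  -- The degree is at most 4: labels 0 and 1 go to the edge vertices, 2 and 3 to the two directions
  -- along the path.
  pathVertex⇒≤ : ∀ {k} {c : Vertex → Fin k} i h → IsBVertex G c (inj₂ (i , h)) → k ≤ 5
  pathVertex⇒≤ i h = bVertex⇒≤ G (inj₂ (i , h)) (λ {w} → label {w})
    (λ {w} {w′} → label-injective {w} {w′})
    where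
    label : ∀ {w} → inj₂ (i , h) ~ w → Fin 4
    label {inj₁ (inj₂ e)} p = incident e (end⇒tail n>2 e p) Fin.↑ˡ 2
    label {inj₂ _} (_ , inj₁ _) = suc (suc zero)
    label {inj₂ _} (_ , inj₂ _) = suc (suc (suc zero))

    ↑ˡ≢ : ∀ (x : Fin 2) y → x Fin.↑ˡ 2 ≢ suc (suc y)
    ↑ˡ≢ zero _ ()
    ↑ˡ≢ (suc zero) _ ()

    label-injective : ∀ {w w′} (p : inj₂ (i , h) ~ w) (q : inj₂ (i , h) ~ w′) →
                      label {w} p ≡ label {w′} q → w ≡ w′
    label-injective {inj₁ (inj₂ e)} {inj₁ (inj₂ f)} p q eq = cong edge
      (incident-injective e f (end⇒tail n>2 e p) (end⇒tail n>2 f q) (Fin.↑ˡ-injective 2 _ _ eq))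
    label-injective {inj₁ (inj₂ _)} {inj₂ _} _ (_ , inj₁ _) eq = contradiction eq (↑ˡ≢ _ _)
    label-injective {inj₁ (inj₂ _)} {inj₂ _} _ (_ , inj₂ _) eq = contradiction eq (↑ˡ≢ _ _)
    label-injective {inj₂ _} {inj₁ (inj₂ _)} (_ , inj₁ _) _ eq = contradiction (sym eq) (↑ˡ≢ _ _)
    label-injective {inj₂ _} {inj₁ (inj₂ _)} (_ , inj₂ _) _ eq = contradiction (sym eq) (↑ˡ≢ _ _)
    label-injective {inj₂ _} {inj₂ _} (refl , inj₁ p) (refl , inj₁ q) _ =
      cong (λ x → inj₂ (i , x)) (toℕ-injective (trans (sym p) q))
    label-injective {inj₂ _} {inj₂ _} (refl , inj₂ p) (refl , inj₂ q) _ =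
      cong (λ x → inj₂ (i , x)) (toℕ-injective (suc-injective (trans p (sym q))))

  -- Each of the two ends contributes itself (`zero`) and the `t` vertices of its copy (`suc h`).
  edgeVertex⇒≤ : ∀ {k} {c : Vertex → Fin k} e → IsBVertex G c (edge e) → k ≤ suc (2 * suc t)
  edgeVertex⇒≤ e = bVertex⇒≤ G (edge e) (λ {w} → label {w})
    (λ {w} {w′} → label-injective {w} {w′})
    where
    open Graph (C n n>2) using (_isEndOf_)

    side : ∀ {u} → u isEndOf e → Fin 2
    side (inj₁ _) = zero
    side (inj₂ _) = suc zero

    side-injective : ∀ {u v} (p : u isEndOf e) (q : v isEndOf e) → side p ≡ side q → u ≡ v
    side-injective (inj₁ refl) (inj₁ refl) _ = refl
    side-injective (inj₂ refl) (inj₂ refl) _ = refl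

    label : ∀ {w} → edge e ~ w → Fin (2 * suc t)
    label {inj₁ (inj₁ _)} p = combine (side p) zero
    label {inj₂ (_ , h)}  p = combine (side p) (suc h)

    label-injective : ∀ {w w′} (p : edge e ~ w) (q : edge e ~ w′) →
                      label {w} p ≡ label {w′} q → w ≡ w′
    label-injective {inj₁ (inj₁ _)} {inj₁ (inj₁ _)} p q eq =
      cong (inj₁ ∘ inj₁) (side-injective p q (proj₁ (combine-injective (side p) zero _ _ eq)))
    label-injective {inj₁ (inj₁ _)} {inj₂ (_ , h)} p q eq =
      contradiction (proj₂ (combine-injective (side p) zero (side q) (suc h) eq)) λ ()
    label-injective {inj₂ (_ , h)} {inj₁ (inj₁ _)} p q eq =
      contradiction (proj₂ (combine-injective (side p) (suc h) (side q) zero eq)) λ ()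
    label-injective {inj₂ (_ , h)} {inj₂ (_ , h′)} p q eq =
      let eq₁ , eq₂ = combine-injective (side p) (suc h) (side q) (suc h′) eq
      in cong₂ (λ x y → inj₂ (x , y)) (side-injective p q eq₁) (Fin.suc-injective eq₂)

  -- Beyond 5 colours every colour has an edge vertex as b-vertex. Distinct colours give distinct
  -- edges, so `k ≤ n`; the degree of any one of these vertices gives the other bound.
  bChromatic⇒≤ : ∀ {k} → HasBChromaticColouring G k → k ≤ 5 ⊎ (k ≤ n × k ≤ suc (2 * suc t))
  bChromatic⇒≤ {k} (c , _ , b) with k ≤? 5
  ... | yes k≤5 = inj₁ k≤5
  ... | no k≰5  =
    inj₂ ( injective⇒≤ centre-injective
         , edgeVertex⇒≤ {c = c} _ (proj₂ (proj₂ (bEdge (fromℕ< (≤-<-trans z≤n (≰⇒> k≰5)))))))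
    where
    bEdge : ∀ x → ∃[ e ] (c (edge e) ≡ x × IsBVertex G c (edge e))
    bEdge x with b x
    ... | inj₁ (inj₁ i) , _ , bv =
      contradiction (≤-trans (cycleVertex⇒≤ {c = c} i bv) (s≤s (s≤s (s≤s z≤n)))) k≰5
    ... | inj₁ (inj₂ e) , p , bv = e , p , bv
    ... | inj₂ (i , h)  , _ , bv = contradiction (pathVertex⇒≤ {c = c} i h bv) k≰5

    centre : Fin k → Fin n
    centre x = tail n>2 (proj₁ (bEdge x))

    centre-injective : ∀ {x y} → centre x ≡ centre y → x ≡ y
    centre-injective {x} {y} eq with bEdge x | bEdge y
    ... | e , p , _ | f , q , _ = trans (sym p) (trans (cong (c ∘ edge) (tail-injective n>2 eq)) q)

-- Colourings given by edge vertex colours and slots.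

module Colouring {n t k : ℕ} (n>2 : n > 2)
  (hub : Fin n → Fin k) (slot : Fin n → ℕ → Fin k) where
  private
    G = C n n>2 ⊡ P t
    open Graph G using (Vertex; _~_)
    open Graph (C n n>2) using (_isEndOf_)

  -- The copy of P t at i occupies the slots 0, …, t − 1 of i, and u_i the slot t.
  colour : Vertex → Fin k
  colour (inj₁ (inj₁ i)) = slot i t
  colour (inj₁ (inj₂ e)) = hub (tail n>2 e)
  colour (inj₂ (i , h))  = slot i (toℕ h)

  -- The edge vertices joined to the slots of a vertex come from the arc leaving it and the arc
  -- entering it; the first two hypotheses handle these, the third handles edges inside a copy.
  colour-isProper : (∀ i s → slot i s ≢ hub i) →
                    (∀ {i j} → Next i j → ∀ s → slot j s ≢ hub i) →
                    (∀ i s → slot i s ≢ slot i (suc s)) → IsProper G colour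
  colour-isProper slot≢hub slot≢prevHub slot≢slot {u} {v} = go {u} {v}
    where
    slot≢edge : ∀ e {i} → i isEndOf e → ∀ s → slot i s ≢ hub (tail n>2 e)
    slot≢edge e p with end⇒tail n>2 e p
    ... | inj₁ refl = slot≢hub _
    ... | inj₂ q    = slot≢prevHub q

    path : ∀ i {s s′} → suc s ≡ s′ → slot i s ≢ slot i s′
    path i refl = slot≢slot i _

    go : ∀ {u v} → u ~ v → colour u ≢ colour v
    go {inj₁ (inj₁ _)} {inj₁ (inj₁ _)} ()
    go {inj₁ (inj₁ _)} {inj₁ (inj₂ e)} p = slot≢edge e p _
    go {inj₁ (inj₁ _)} {inj₂ _} ()
    go {inj₁ (inj₂ e)} {inj₁ (inj₁ _)} p = slot≢edge e p _ ∘ sym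
    go {inj₁ (inj₂ _)} {inj₁ (inj₂ _)} ()
    go {inj₁ (inj₂ e)} {inj₂ _} p = slot≢edge e p _ ∘ sym
    go {inj₂ _} {inj₁ (inj₁ _)} ()
    go {inj₂ _} {inj₁ (inj₂ e)} p = slot≢edge e p _
    go {inj₂ (i , _)} {inj₂ _} (refl , inj₁ p) = path i p
    go {inj₂ (i , _)} {inj₂ _} (refl , inj₂ p) = path i p ∘ sym

  slotVertex : ∀ i s → s ≤ t →
    ∃[ v ] (colour v ≡ slot i s × (∀ {e} → i isEndOf e → edge {t = t} n>2 e ~ v))
  slotVertex i s s≤t with s <? t
  ... | yes s<t = inj₂ (i , fromℕ< s<t) , cong (slot i) (toℕ-fromℕ< s<t) , λ p → p
  ... | no s≮t  = inj₁ (inj₁ i) , cong (slot i) (≤-antisym (≮⇒≥ s≮t) s≤t) , λ p → p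

  edge-isBVertex : ∀ i →
    (∀ x → x ≢ hub i →
      ∃[ s ] (s ≤ t × (slot i s ≡ x ⊎ ∃[ j ] (Next i j × slot j s ≡ x)))) →
    ∃[ v ] (colour v ≡ hub i × IsBVertex G colour v)
  edge-isBVertex i covers with tail-surjective n>2 i
  ... | e , refl = edge n>2 e , refl , b
    where
    b : IsBVertex G colour (edge n>2 e)
    b x x≢ with covers x x≢
    ... | s , s≤t , inj₁ p =
      let v , q , adj = slotVertex i s s≤t
      in v , adj {e} (tail-isEnd n>2 e) , trans q p
    ... | s , s≤t , inj₂ (j , i→j , p) =
      let v , q , adj = slotVertex j s s≤t
      in v , adj {e} (next-isEnd n>2 e i→j) , trans q p

  -- As `t > 2`, the second path vertex has two path neighbours, in slots 0 and 2; with the two edge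
  -- vertices these give the four colours offered by the hypothesis.
  path-isBVertex : t > 2 → ∀ {i j} → Next i j →
    (∀ x → x ≢ slot j 1 → (x ≡ hub i ⊎ x ≡ hub j) ⊎ (x ≡ slot j 0 ⊎ x ≡ slot j 2)) →
    ∃[ v ] (colour v ≡ slot j 1 × IsBVertex G colour v)
  path-isBVertex t>2 {i} {j} i→j covers =
    centre , colour-at 1<t , λ x x≢ → b x (covers x (x≢ ∘ λ p → trans p (sym (colour-at 1<t))))
    where
    0<t = ≤-trans (s≤s z≤n) t>2
    1<t = ≤-trans (s≤s (s≤s z≤n)) t>2

    at : ∀ {s} → s < t → Vertex
    at s<t = inj₂ (j , fromℕ< s<t)

    colour-at : ∀ {s} (s<t : s < t) → colour (at s<t) ≡ slot j s
    colour-at s<t = cong (slot j) (toℕ-fromℕ< s<t)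

    consecutive : ∀ {s} (p : s < t) (q : suc s < t) →
                  suc (toℕ (fromℕ< p)) ≡ toℕ (fromℕ< q)
    consecutive p q = trans (cong suc (toℕ-fromℕ< p)) (sym (toℕ-fromℕ< q))

    centre = at 1<t

    b : ∀ x → (x ≡ hub i ⊎ x ≡ hub j) ⊎ (x ≡ slot j 0 ⊎ x ≡ slot j 2) →
        ∃[ w ] (centre ~ w × colour w ≡ x)
    b _ (inj₁ (inj₁ refl)) with tail-surjective n>2 i
    ... | e , refl = edge n>2 e , next-isEnd n>2 e i→j , refl
    b _ (inj₁ (inj₂ refl)) with tail-surjective n>2 j
    ... | e , refl = edge n>2 e , tail-isEnd n>2 e , refl
    b _ (inj₂ (inj₁ refl)) = at 0<t , (refl , inj₂ (consecutive 0<t 1<t)) , colour-at 0<t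
    b _ (inj₂ (inj₂ refl)) = at t>2 , (refl , inj₁ (consecutive 1<t t>2)) , colour-at t>2

-- The cases n = 3 and n = 4, by finite tables.

zigzag : ℕ → Fin 3
zigzag 0 = zero
zigzag 1 = suc zero
zigzag 2 = suc (suc zero)
-- From here 1 and 2 alternate, so slots 0, 1, 2 show all three entries and any longer path stays
-- proper.
zigzag (suc (suc (suc s))) = zigzag (suc s)

zigzag-step : ∀ s → zigzag s ≢ zigzag (suc s)
zigzag-step 0 ()
zigzag-step 1 ()
zigzag-step 2 ()
zigzag-step (suc (suc (suc s))) = zigzag-step (suc s)

zigzag-toℕ : ∀ x → zigzag (toℕ x) ≡ x
zigzag-toℕ zero = refl
zigzag-toℕ (suc zero) = refl
zigzag-toℕ (suc (suc zero)) = refl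

next? : ∀ {n} → Decidable (Next {n})
next? {n} i j =
  (suc (toℕ i) ≟ toℕ j) ⊎-dec ((suc (toℕ i) ≟ n) ×-dec (toℕ j ≟ 0))

-- The i-th copy of P t is coloured row i 0, row i 1, row i 2, row i 1, row i 2, …
module Table {n k : ℕ} (hub : Fin n → Fin k) (row : Fin n → Fin 3 → Fin k) where

  record IsGood : Set where
    field
      row-injective : ∀ i x y → x ≢ y → row i x ≢ row i y
      row≢hub       : ∀ i x → row i x ≢ hub i
      row≢prevHub   : ∀ i j → Next i j → ∀ x → row j x ≢ hub i
      edge-covers   : ∀ i y → y ≢ hub i →
                      ∃[ x ] (row i x ≡ y ⊎ ∃[ j ] (Next i j × row j x ≡ y))
      path-covers   : ∀ i j → Next i j → ∀ y → y ≢ row j (suc zero) →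
                      (y ≡ hub i ⊎ y ≡ hub j) ⊎
                      (y ≡ row j zero ⊎ y ≡ row j (suc (suc zero)))
      onto          : ∀ y → ∃[ i ] (hub i ≡ y) ⊎
                      ∃[ i ] ∃[ j ] (Next i j × row j (suc zero) ≡ y)

  -- Every condition quantifies over finite types, so a concrete table is verified by evaluation.
  isGood? : Dec IsGood
  isGood? = map′
    (λ { (a , b , c , d , e , f) → record
      { row-injective = a ; row≢hub = b ; row≢prevHub = c
      ; edge-covers = d ; path-covers = e ; onto = f } })
    (λ g → let open IsGood g in
      row-injective , row≢hub , row≢prevHub , edge-covers , path-covers , onto)
    (  (all? λ i → all? λ x → all? λ y → ¬? (x Fin.≟ y) →-dec ¬? (row i x Fin.≟ row i y))
    ×-dec (all? λ i → all? λ x → ¬? (row i x Fin.≟ hub i))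
    ×-dec (all? λ i → all? λ j → next? i j →-dec all? λ x → ¬? (row j x Fin.≟ hub i))
    ×-dec (all? λ i → all? λ y → ¬? (y Fin.≟ hub i) →-dec any? λ x →
             ((row i x Fin.≟ y) ⊎-dec any? λ j → next? i j ×-dec (row j x Fin.≟ y)))
    ×-dec (all? λ i → all? λ j → next? i j →-dec all? λ y → ¬? (y Fin.≟ row j (suc zero)) →-dec
             (((y Fin.≟ hub i) ⊎-dec (y Fin.≟ hub j)) ⊎-dec
              ((y Fin.≟ row j zero) ⊎-dec (y Fin.≟ row j (suc (suc zero))))))
    ×-dec (all? λ y → any? (λ i → hub i Fin.≟ y) ⊎-dec
             any? λ i → any? λ j → next? i j ×-dec (row j (suc zero) Fin.≟ y)))

  isGood⇒bChromatic : ∀ {t} (n>2 : n > 2) → t > 2 → IsGood →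
                      HasBChromaticColouring (C n n>2 ⊡ P t) k
  isGood⇒bChromatic {t} n>2 t>2 good = colour , (λ {u} {v} → proper {u} {v}) , b
    where
    open IsGood good
    open Colouring {t = t} n>2 hub (λ i s → row i (zigzag s))

    proper : IsProper (C n n>2 ⊡ P t) colour
    proper {u} {v} = colour-isProper
      (λ i _ → row≢hub i _) (λ i→j _ → row≢prevHub _ _ i→j _)
      (λ i s → row-injective i _ _ (zigzag-step s)) {u} {v}

    covers : ∀ i y → y ≢ hub i → ∃[ s ] (s ≤ t × (row i (zigzag s) ≡ y ⊎
             ∃[ j ] (Next i j × row j (zigzag s) ≡ y)))
    covers i y y≢ with edge-covers i y y≢
    ... | x , p = toℕ x , <⇒≤ (≤-trans (toℕ<n x) t>2) ,
      subst (λ z → row i z ≡ y ⊎ ∃[ j ] (Next i j × row j z ≡ y)) (sym (zigzag-toℕ x)) p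

    b : ∀ y → ∃[ v ] (colour v ≡ y × IsBVertex (C n n>2 ⊡ P t) colour v)
    b y with onto y
    ... | inj₁ (i , refl)           = edge-isBVertex i (covers i)
    ... | inj₂ (i , j , i→j , refl) = path-isBVertex t>2 i→j (path-covers i j i→j)

triangle-bChromatic : ∀ {t} (3>2 : 3 > 2) → t > 2 → HasBChromaticColouring (C 3 3>2 ⊡ P t) 5
triangle-bChromatic 3>2 t>2 = isGood⇒bChromatic 3>2 t>2 (from-yes isGood?)
  where
  -- Each row permutes the three colours not on the two edge vertices at its vertex. The middle
  -- entries 3 and 4 supply the b-vertices of the colours that no edge vertex has.
  open Table (λ i → Fin.inject≤ i (m≤m+n 3 2)) (λ i → lookup (lookup
    ( (# 1 ∷ # 3 ∷ # 4 ∷ [])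
    ∷ (# 2 ∷ # 4 ∷ # 3 ∷ [])
    ∷ (# 0 ∷ # 3 ∷ # 4 ∷ [])
    ∷ []) i))

square-bChromatic : ∀ {t} (4>2 : 4 > 2) → t > 2 → HasBChromaticColouring (C 4 4>2 ⊡ P t) 5
square-bChromatic 4>2 t>2 = isGood⇒bChromatic 4>2 t>2 (from-yes isGood?)
  where
  -- Again each row holds the three colours left by its two edge vertices; the middle entry is
  -- always 4, the only colour absent from the edge vertices.
  open Table (λ i → Fin.inject≤ i (m≤m+n 4 1)) (λ i → lookup (lookup
    ( (# 1 ∷ # 4 ∷ # 2 ∷ [])
    ∷ (# 2 ∷ # 4 ∷ # 3 ∷ [])
    ∷ (# 0 ∷ # 4 ∷ # 3 ∷ [])
    ∷ (# 0 ∷ # 4 ∷ # 1 ∷ [])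
    ∷ []) i))

-- Rotations of the residues modulo k.

module _ {k : ℕ} .{{_ : NonZero k}} where

  %-absorbˡ-+ : ∀ a b → (a % k + b) % k ≡ (a + b) % k
  %-absorbˡ-+ a b = trans (%-distribˡ-+ (a % k) b k)
    (trans (cong (λ z → (z + b % k) % k) (m%n%n≡m%n a k)) (sym (%-distribˡ-+ a b k)))

  shift : Fin k → ℕ → Fin k
  shift a d = (toℕ a + d) mod k

  private
    toℕ-mod : ∀ a → toℕ (a mod k) ≡ a % k
    toℕ-mod a = toℕ-fromℕ< (m%n<n a k)

    complement : (a : Fin k) → toℕ a + (k ∸ toℕ a) ≡ k
    complement a = m+[n∸m]≡n (<⇒≤ (toℕ<n a))

  shift-0 : ∀ a → shift a 0 ≡ a
  shift-0 a = toℕ-injective (trans (toℕ-mod _)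
    (trans (cong (_% k) (+-identityʳ (toℕ a))) (m<n⇒m%n≡m (toℕ<n a))))

  -- Passing to the successor adds 1 even when it wraps around. Thus offsets at the head of an arc
  -- count one more when seen from its tail.
  shift-next : ∀ {a b} → Next a b → ∀ d → shift b d ≡ shift a (suc d)
  shift-next {a} (inj₁ p) d =
    cong (_mod k) (trans (cong (_+ d) (sym p)) (sym (+-suc (toℕ a) d)))
  shift-next {a} {b} (inj₂ (p , z)) d = toℕ-injective (begin
    toℕ (shift b d)       ≡⟨ toℕ-mod _ ⟩
    (toℕ b + d) % k       ≡⟨ cong (λ z → (z + d) % k) z ⟩
    d % k                 ≡⟨ [m+n]%n≡m%n d k ⟨
    (d + k) % k           ≡⟨ cong (_% k) (+-comm d k) ⟩
    (k + d) % k           ≡⟨ cong (λ z → (z + d) % k) p ⟨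
    (suc (toℕ a) + d) % k ≡⟨ cong (_% k) (+-suc (toℕ a) d) ⟨
    (toℕ a + suc d) % k   ≡⟨ toℕ-mod _ ⟨
    toℕ (shift a (suc d)) ∎)
    where open ≡-Reasoning

  -- The residue of x - a, written without leaving the natural numbers.
  unshift : Fin k → Fin k → ℕ
  unshift a x = (toℕ x + (k ∸ toℕ a)) % k

  unshift-shift : ∀ a {d} → d < k → unshift a (shift a d) ≡ d
  unshift-shift a {d} d<k = begin
    (toℕ (shift a d) + (k ∸ toℕ a)) % k   ≡⟨ cong (λ z → (z + (k ∸ toℕ a)) % k) (toℕ-mod _) ⟩
    ((toℕ a + d) % k + (k ∸ toℕ a)) % k   ≡⟨ %-absorbˡ-+ (toℕ a + d) _ ⟩
    (toℕ a + d + (k ∸ toℕ a)) % k         ≡⟨ cong (λ z → (z + (k ∸ toℕ a)) % k) (+-comm (toℕ a) d) ⟩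
    (d + toℕ a + (k ∸ toℕ a)) % k         ≡⟨ cong (_% k) (+-assoc d _ _) ⟩
    (d + (toℕ a + (k ∸ toℕ a))) % k       ≡⟨ cong (λ z → (d + z) % k) (complement a) ⟩
    (d + k) % k                           ≡⟨ [m+n]%n≡m%n d k ⟩
    d % k                                 ≡⟨ m<n⇒m%n≡m d<k ⟩
    d                                     ∎
    where open ≡-Reasoning

  shift-unshift : ∀ a x → shift a (unshift a x) ≡ x
  shift-unshift a x = toℕ-injective (begin
    toℕ (shift a (unshift a x))               ≡⟨ toℕ-mod _ ⟩
    (toℕ a + (toℕ x + (k ∸ toℕ a)) % k) % k   ≡⟨ cong (_% k) (+-comm (toℕ a) _) ⟩
    ((toℕ x + (k ∸ toℕ a)) % k + toℕ a) % k   ≡⟨ %-absorbˡ-+ (toℕ x + (k ∸ toℕ a)) _ ⟩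
    (toℕ x + (k ∸ toℕ a) + toℕ a) % k         ≡⟨ cong (_% k) (+-assoc (toℕ x) _ _) ⟩
    (toℕ x + ((k ∸ toℕ a) + toℕ a)) % k       ≡⟨ cong (λ z → (toℕ x + z) % k) (m∸n+n≡m (<⇒≤ (toℕ<n a))) ⟩
    (toℕ x + k) % k                           ≡⟨ [m+n]%n≡m%n (toℕ x) k ⟩
    toℕ x % k                                 ≡⟨ m<n⇒m%n≡m (toℕ<n x) ⟩
    toℕ x                                     ∎)
    where open ≡-Reasoning

  shift-injective : ∀ a {d d′} → d < k → d′ < k → shift a d ≡ shift a d′ → d ≡ d′
  shift-injective a d<k d′<k eq =
    trans (sym (unshift-shift a d<k)) (trans (cong (unshift a) eq) (unshift-shift a d′<k))

  shift-moves : ∀ a {d} → 0 < d → d < k → shift a d ≢ a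
  shift-moves a 0<d d<k eq =
    <⇒≢ 0<d (shift-injective a (<-trans 0<d d<k) d<k (trans (shift-0 a) (sym eq)))

-- The colours 0, ..., k, 0, 0, ... of the edge vertices.

module _ {n k : ℕ} where

  truncate : Fin n → Fin (suc k)
  truncate i with toℕ i <? suc k
  ... | yes i<k = fromℕ< i<k
  ... | no  _   = zero

  truncate-inject≤ : (k<n : suc k ≤ n) → ∀ x → truncate (Fin.inject≤ x k<n) ≡ x
  truncate-inject≤ k<n x with toℕ (Fin.inject≤ x k<n) <? suc k
  ... | yes p = toℕ-injective (trans (toℕ-fromℕ< p) (Fin.toℕ-inject≤ x k<n))
  ... | no ¬p = contradiction (subst (_< suc k) (sym (Fin.toℕ-inject≤ x k<n)) (toℕ<n x)) ¬p

  -- Index `k` is followed either by index 0, when `n` equals `suc k`, or by the constant stretch;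
  -- both have colour `zero`, the cyclic successor of the last colour.
  truncate-next : suc k ≤ n → ∀ {i j : Fin n} → toℕ i < suc k → Next i j →
                  Next (truncate i) (truncate j)
  truncate-next k<n {i} {j} i<k i→j with toℕ i <? suc k | toℕ j <? suc k
  ... | no i≮k | _ = contradiction i<k i≮k
  ... | yes p | yes q with i→j
  ...   | inj₁ r       = inj₁ (trans (cong suc (toℕ-fromℕ< p)) (trans r (sym (toℕ-fromℕ< q))))
  ...   | inj₂ (r , z) = inj₂ ( trans (cong suc (toℕ-fromℕ< p))
                                  (≤-antisym i<k (subst (suc k ≤_) (sym r) k<n))
                              , trans (toℕ-fromℕ< q) z )
  truncate-next k<n {i} {j} i<k i→j | yes p | no j≮k with i→j
  ... | inj₁ r       = inj₂ ( trans (cong suc (toℕ-fromℕ< p))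
                                (≤-antisym i<k (subst (suc k ≤_) (sym r) (≮⇒≥ j≮k)))
                            , refl )
  ... | inj₂ (_ , z) = contradiction (subst (_< suc k) (sym z) z<s) j≮k

  -- Beyond index `k` everything is `zero`, and the arc closing the cycle leads to index 0, which is
  -- `zero` too.
  truncate-const : ∀ {i j : Fin n} → ¬ toℕ i < suc k → Next i j → truncate j ≡ truncate i
  truncate-const {i} {j} i≮k i→j with toℕ i <? suc k | toℕ j <? suc k
  ... | yes i<k | _    = contradiction i<k i≮k
  ... | no _    | no _ = refl
  ... | no _ | yes j<k with i→j
  ...   | inj₁ r       = contradiction (<-trans (≤-reflexive r) j<k) i≮k
  ...   | inj₂ (_ , z) = toℕ-injective (trans (toℕ-fromℕ< j<k) z)

-- Offsets that cover the nonzero residues.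

half-split : ∀ d → ∃[ j ] (d ≡ j + j ⊎ d ≡ suc (j + j))
half-split zero = 0 , inj₁ refl
half-split (suc d) with half-split d
... | j , inj₁ p = j , inj₂ (cong suc p)
... | j , inj₂ p = suc j , inj₁ (trans (cong suc p) (cong suc (sym (+-suc j j))))

-- The offsets 1, 3, 5, … below q + 2, followed by q + 2 itself. Together with
-- their successors they are all of 1, …, q + 3, the nonzero residues modulo q + 4.
module Offsets (q : ℕ) where
  m : ℕ
  m = 2 + ⌊ q /2⌋

  -- For indices below `m` the cap acts only on the last one, for even `q`: it lowers `q + 3`, which
  -- is -1 modulo `q + 4` and would repeat the colour of the preceding edge vertex.
  offset : ℕ → ℕ
  offset j = suc ((j + j) ⊓ suc q)

  offset<3+q : ∀ j → offset j < 3 + q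
  offset<3+q j = s≤s (s≤s (m⊓n≤n (j + j) (suc q)))

  offset-mono-< : ∀ {i j} → i < j → j < m → offset i < offset j
  offset-mono-< {i} {j} i<j j<m = s<s (≤-<-trans (m⊓n≤m (i + i) (suc q))
    (⊓-pres-m< (+-mono-< i<j i<j) (s≤s i+i≤q)))
    where
    -- A larger index lies below `m`, so `i` is not the last one and its double stays under the cap.
    i≤half : i ≤ ⌊ q /2⌋
    i≤half = ≤-pred (≤-trans i<j (≤-pred j<m))

    i+i≤q : i + i ≤ q
    i+i≤q = ≤-trans (+-mono-≤ i≤half (≤-trans i≤half (⌊n/2⌋≤⌈n/2⌉ q)))
      (≤-reflexive (⌊n/2⌋+⌈n/2⌉≡n q))

  offset-injective : ∀ {i j} → i < m → j < m → offset i ≡ offset j → i ≡ j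
  offset-injective {i} {j} i<m j<m eq with <-cmp i j
  ... | tri< i<j _ _ = contradiction eq (<⇒≢ (offset-mono-< i<j j<m))
  ... | tri≈ _ p _   = p
  ... | tri> _ _ j<i = contradiction (sym eq) (<⇒≢ (offset-mono-< j<i i<m))

  offset-covers : ∀ {d} → 0 < d → d < 4 + q →
                  ∃[ j ] (j < m × (offset j ≡ d ⊎ suc (offset j) ≡ d))
  offset-covers {suc d} _ d<k = locate (half-split d)
    where
    below : ∀ {j} → j + j ≤ d → j < m
    below {j} p = begin
      suc j                ≡⟨ n≡⌊n+n/2⌋ (suc j) ⟩
      ⌊ suc j + suc j /2⌋  ≡⟨ cong (λ z → ⌊ suc z /2⌋) (+-suc j j) ⟩
      ⌊ 2 + (j + j) /2⌋    ≤⟨ ⌊n/2⌋-mono (≤-trans (s≤s (s≤s p)) d<k) ⟩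
      m                    ∎
      where open ≤-Reasoning

    locate : ∃[ j ] (d ≡ j + j ⊎ d ≡ suc (j + j)) →
           ∃[ j ] (j < m × (offset j ≡ suc d ⊎ suc (offset j) ≡ suc d))
    locate (j , inj₂ refl) = j , below (n≤1+n _) ,
      inj₂ (cong (2 +_) (m≤n⇒m⊓n≡m (≤-pred (≤-pred (≤-pred d<k)))))
    locate (j , inj₁ refl) with j + j ≤? suc q
    ... | yes p = j , below ≤-refl , inj₁ (cong suc (m≤n⇒m⊓n≡m p))
    -- Here `d` must be `q + 2`: the top residue `q + 3` is the successor of the capped offset.
    ... | no ¬p = j , below ≤-refl , inj₂ (cong suc
      (trans (cong suc (m≥n⇒m⊓n≡n (<⇒≤ (≰⇒> ¬p))))
        (≤-antisym (≰⇒> ¬p) (≤-pred (≤-pred d<k)))))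

-- The cyclic colouring with at least four colours.

%-step : ∀ {m} .{{_ : NonZero m}} → 1 < m → ∀ s → s % m ≢ suc s % m
%-step {m} 1<m s eq = shift-moves (s mod m) z<s 1<m (toℕ-injective (begin
  toℕ (shift (s mod m) 1)  ≡⟨ toℕ-fromℕ< _ ⟩
  (toℕ (s mod m) + 1) % m  ≡⟨ cong (λ z → (z + 1) % m) (toℕ-fromℕ< _) ⟩
  (s % m + 1) % m          ≡⟨ %-absorbˡ-+ s 1 ⟩
  (s + 1) % m              ≡⟨ cong (_% m) (+-comm s 1) ⟩
  suc s % m                ≡⟨ eq ⟨
  s % m                    ≡⟨ toℕ-fromℕ< _ ⟨
  toℕ (s mod m)            ∎))
  where open ≡-Reasoning

cyclic-bChromatic : ∀ {n t q} (n>2 : n > 2) → 4 + q ≤ n → 4 + q ≤ 3 + (t + t) →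
                    HasBChromaticColouring (C n n>2 ⊡ P t) (4 + q)
cyclic-bChromatic {n} {t} {q} n>2 k≤n k≤3+2t = colour , (λ {u} {v} → proper {u} {v}) , b
  where
  k = 4 + q
  open Offsets q

  r : Fin n → Fin k
  r = truncate

  slot : Fin n → ℕ → Fin k
  slot i s = shift (r i) (offset (s % m))

  open Colouring {t = t} n>2 r slot

  offset<k : ∀ j → offset j < k
  offset<k j = m<n⇒m<1+n (offset<3+q j)

  slot≢prevHub : ∀ {i j} → Next i j → ∀ s → slot j s ≢ r i
  slot≢prevHub {i} {j} i→j s eq = refute (toℕ i <? k)
    where
    refute : Dec (toℕ i < k) → ⊥
    -- The edge vertex colour advances by 1 along this arc, so the slot lies `offset + 1` past
    -- `r i`, and offsets stay below k - 1.
    refute (yes i<k) = shift-moves (r i) z<s (s<s (offset<3+q (s % m)))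
                         (trans (sym (shift-next (truncate-next k≤n i<k i→j) _)) eq)
    -- Here `r i` and `r j` agree, so it suffices that the offset is nonzero modulo `k`.
    refute (no i≮k)  = shift-moves (r j) z<s (offset<k (s % m))
                         (trans eq (sym (truncate-const i≮k i→j)))

  proper : IsProper (C n n>2 ⊡ P t) colour
  proper {u} {v} = colour-isProper
    (λ i s → shift-moves (r i) z<s (offset<k (s % m)))
    slot≢prevHub
    (λ i s → %-step (s<s z<s) s ∘
      offset-injective (m%n<n s m) (m%n<n (suc s) m) ∘
      shift-injective (r i) (offset<k (s % m)) (offset<k (suc s % m)))
    {u} {v}

  -- Each vertex has `t + 1` slots, enough for all ⌊k/2⌋ offsets; this is where k ≤ 2t + 3 enters.
  m≤1+t : m ≤ suc t
  m≤1+t = begin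
    m                    ≤⟨ ⌊n/2⌋-mono k≤3+2t ⟩
    ⌊ 3 + (t + t) /2⌋    ≡⟨ cong suc (n≡⌈n+n/2⌉ t) ⟨
    suc t                ∎
    where open ≤-Reasoning

  covers : ∀ i → toℕ i < k → ∀ x → x ≢ r i →
           ∃[ s ] (s ≤ t × (slot i s ≡ x ⊎ ∃[ j ] (Next i j × slot j s ≡ x)))
  -- The nonzero difference from `r i` to `x` is an offset, found at `i`, or the successor of one,
  -- found at the head of the arc.
  covers i i<k x x≢ = let j , j<m , cov = offset-covers (n≢0⇒n>0 d≢0) (m%n<n (toℕ x + (k ∸ toℕ (r i))) k)
                      in j , ≤-pred (≤-trans j<m m≤1+t) , hit j<m cov
    where
    d : ℕ
    d = unshift (r i) x

    d≢0 : d ≢ 0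
    d≢0 d≡0 = x≢ (trans (sym (shift-unshift (r i) x))
      (trans (cong (shift (r i)) d≡0) (shift-0 (r i))))

    hit : ∀ {j} → j < m → offset j ≡ d ⊎ suc (offset j) ≡ d →
          slot i j ≡ x ⊎ ∃[ i′ ] (Next i i′ × slot i′ j ≡ x)
    hit j<m (inj₁ p) = inj₁ (trans
      (cong (shift (r i)) (trans (cong offset (m<n⇒m%n≡m j<m)) p)) (shift-unshift (r i) x))
    hit j<m (inj₂ p) with next-total i
    ... | i′ , i→i′ = inj₂ (i′ , i→i′ , trans (shift-next (truncate-next k≤n i<k i→i′) _)
      (trans (cong (shift (r i)) (trans (cong (λ z → suc (offset z)) (m<n⇒m%n≡m j<m)) p))
        (shift-unshift (r i) x)))

  b : ∀ x → ∃[ v ] (colour v ≡ x × IsBVertex (C n n>2 ⊡ P t) colour v)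
  b x =
    let i          = Fin.inject≤ x k≤n
        v , p , bv = edge-isBVertex i
          (covers i (subst (_< k) (sym (Fin.toℕ-inject≤ x k≤n)) (toℕ<n x)))
    in v , trans p (truncate-inject≤ k≤n x) , bv

-- Matching the bounds in the three ranges of n.

theorem11 : (n t : ℕ) (n>2 : n > 2) → t > 2 →
    (n ≡ 3 ⊎ n ≡ 4 → φ (C n n>2 ⊡ P t) ≡ 5)
    × (5 ≤ n × n ≤ 2 * t + 2 → φ (C n n>2 ⊡ P t) ≡ n)
    × (¬ (n ≡ 3 ⊎ n ≡ 4) → ¬ (5 ≤ n × n ≤ 2 * t + 2) → φ (C n n>2 ⊡ P t) ≡ (2 * t + 3))
theorem11 n t n>2 t>2 = small , medium , large
  where
  2t+3≡ : 2 * t + 3 ≡ 3 + (t + t)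
  2t+3≡ = trans (+-comm (2 * t) 3) (cong (λ z → 3 + (t + z)) (+-identityʳ t))

  bound≡ : suc (2 * suc t) ≡ 2 * t + 3
  bound≡ = trans (cong suc (*-suc 2 t)) (+-comm 3 (2 * t))

  2t+3≡1+ : 2 * t + 3 ≡ suc (2 * t + 2)
  2t+3≡1+ = +-suc (2 * t) 2

  cyclic : ∀ {k} → 5 ≤ k → k ≤ n → k ≤ 3 + (t + t) → HasBChromaticColouring (C n n>2 ⊡ P t) k
  cyclic (s≤s (s≤s (s≤s (s≤s _)))) = cyclic-bChromatic n>2

  small : n ≡ 3 ⊎ n ≡ 4 → φ (C n n>2 ⊡ P t) ≡ 5
  small (inj₁ refl) = triangle-bChromatic n>2 t>2 ,
    λ l b → [ (λ p → p) , (λ p → ≤-trans (proj₁ p) (m≤m+n 3 2)) ]′ (bChromatic⇒≤ n>2 b)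
  small (inj₂ refl) = square-bChromatic n>2 t>2 ,
    λ l b → [ (λ p → p) , (λ p → ≤-trans (proj₁ p) (m≤m+n 4 1)) ]′ (bChromatic⇒≤ n>2 b)

  medium : 5 ≤ n × n ≤ 2 * t + 2 → φ (C n n>2 ⊡ P t) ≡ n
  medium (5≤n , n≤) =
    cyclic 5≤n ≤-refl (≤-trans (m≤n⇒m≤1+n n≤) (≤-reflexive (trans (sym 2t+3≡1+) 2t+3≡))) ,
    λ l b → [ (λ l≤5 → ≤-trans l≤5 5≤n) , proj₁ ]′ (bChromatic⇒≤ n>2 b)

  large : ¬ (n ≡ 3 ⊎ n ≡ 4) → ¬ (5 ≤ n × n ≤ 2 * t + 2) → φ (C n n>2 ⊡ P t) ≡ (2 * t + 3)
  large n∉ n≰ =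
    cyclic 5≤2t+3 2t+3≤n (≤-reflexive 2t+3≡) ,
    λ l b → [ (λ l≤5 → ≤-trans l≤5 5≤2t+3) , (λ p → subst (l ≤_) bound≡ (proj₂ p)) ]′
      (bChromatic⇒≤ n>2 b)
    where
    -- Excluding 3 and 4 leaves n ≥ 5, so the other negated hypothesis can only mean n ≥ 2t + 3.
    5≤n : 5 ≤ n
    5≤n = ≤∧≢⇒< (≤∧≢⇒< n>2 (n∉ ∘ inj₁ ∘ sym)) (n∉ ∘ inj₂ ∘ sym)

    5≤2t+3 : 5 ≤ 2 * t + 3
    5≤2t+3 = +-monoˡ-≤ 3 (≤-trans (<⇒≤ t>2) (m≤m+n t (t + 0)))

    2t+3≤n : 2 * t + 3 ≤ n
    2t+3≤n = subst (_≤ n) (sym 2t+3≡1+) (≰⇒> (n≰ ∘ (5≤n ,_)))
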